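{- The following hold: (1) $\mathbf K$ is strongly complete for $\mathrm{EL}$: for any $\mathcal{EL}$-formula $\varphi$ and any set $\Phi$ of $\mathcal{EL}$-formulas, if $\Phi\models_{\mathrm{EL}}\varphi$ then $\Phi\vdash_{\mathbf K}\varphi$. (2) $\mathbf{K(C)}$ is weakly complete for $\mathrm{ELC}$: for any $\mathcal{ELC}$-formula $\varphi$, if $\varphi$ is valid then $\vdash_{\mathbf{K(C)}}\varphi$. (3) $\mathbf{K(D)}$ is strongly complete for $\mathrm{ELD}$: for any $\mathcal{ELD}$-formula $\varphi$ and any set $\Phi$ of $\mathcal{ELD}$-formulas, if $\Phi\models_{\mathrm{ELD}}\varphi$ then $\Phi\vdash_{\mathbf{K(D)}}\varphi$. (4) $\mathbf{K(CD)}$ is weakly complete for $\mathrm{ELCD}$: for any $\mathcal{ELCD}$-formula $\varphi$, if $\varphi$ is valid then $\vdash_{\mathbf{K(CD)}}\varphi$. (5) $\mathbf{KB}$ is strongly complete with respect to the class of all symmetric models: for any $\mathcal{EL}$-formula $\varphi$ and any set $\Phi$ of $\mathcal{EL}$-formulas, if every state of every symmetric model satisfying all of $\Phi$ satisfies $\varphi$, then $\Phi\vdash_{\mathbf{KB}}\varphi$.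
   Context: Languages. Fix a countably infinite set $\mathsf{Prop}$ and a finite nonempty set $\mathsf{Ag}$ of agents; groups are nonempty subsets of $\mathsf{Ag}$. $\mathcal{EL}$-formulas: $\varphi::=p\mid\neg\varphi\mid(\varphi\to\varphi)\mid K_a\varphi$. $\mathcal{ELC}$ adds $C_G\varphi$, $\mathcal{ELD}$ adds $D_G\varphi$, $\mathcal{ELCD}$ adds both ($G$ a group). $E_G\varphi:=\bigwedge_{a\in G}K_a\varphi$, $E_G^1\varphi:=E_G\varphi$, $E_G^{n}\varphi:=E_GE_G^{n-1}\varphi$. Models. A model is $M=(W,A,E,C,\nu)$ with $W\neq\emptyset$, $A$ an arbitrary set, $E:W\times W\to\wp(A)$, $C:\mathsf{Ag}\to\wp(A)$, $\nu:W\to\wp(\mathsf{Prop})$. It is symmetric if $E(s,t)=E(t,s)$ for all $s,t$. Satisfaction: $M,s\models p$ iff $p\in\nu(s)$; Booleans as usual; $M,s\models K_a\psi$ iff $M,t\models\psi$ for all $t$ with $C(a)\subseteq E(s,t)$; $M,s\models C_G\psi$ iff $M,s\models E_G^n\psi$ for all $n\ge1$; $M,s\models D_G\psi$ iff $M,t\models\psi$ for all $t$ with $\bigcup_{a\in G}C(a)\subseteq E(s,t)$. A formula is valid if true at all states of all models. $\Phi\models_{\mathrm{EL}}\varphi$ (resp. $\Phi\models_{\mathrm{ELD}}\varphi$) means: every state of every model satisfying all formulas of $\Phi$ satisfies $\varphi$. Axiomatic systems (schemes over the respective language). $\mathbf K$: all instances of propositional tautologies; $K_a(\varphi\to\psi)\to(K_a\varphi\to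 K_a\psi)$; rules: from $\varphi$ and $\varphi\to\psi$ infer $\psi$; from $\varphi$ infer $K_a\varphi$. $\mathbf{KB}$: $\mathbf K$ plus $\varphi\to K_a\neg K_a\neg\varphi$. $\mathbf{K(C)}$: $\mathbf K$ plus the axiom $C_G\varphi\to\bigwedge_{a\in G}K_a(\varphi\wedge C_G\varphi)$ and the rule: from $\varphi\to\bigwedge_{a\in G}K_a(\varphi\wedge\psi)$ infer $\varphi\to C_G\psi$. $\mathbf{K(D)}$: $\mathbf K$ plus $D_G(\varphi\to\psi)\to(D_G\varphi\to D_G\psi)$, $D_{\{a\}}\varphi\leftrightarrow K_a\varphi$, and $D_G\varphi\to D_H\varphi$ for $G\subseteq H$. $\mathbf{K(CD)}$: $\mathbf K$ plus all the additions of $\mathbf{K(C)}$ and of $\mathbf{K(D)}$. $\vdash_{\mathbf\Lambda}\varphi$ means $\varphi$ is a theorem of $\mathbf\Lambda$; $\Phi\vdash_{\mathbf\Lambda}\varphi$ means there is a finite $\Phi_0\subseteq\Phi$ with $\vdash_{\mathbf\Lambda}\bigwedge\Phi_0\to\varphi$. -}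

module Defs where

open import Axiom.ExcludedMiddle using (ExcludedMiddle)
open import Data.Bool.Base using (Bool; true; false; not; _∨_)
open import Data.Fin.Base using (Fin)
open import Data.Fin.Subset using (Subset; Nonempty; ⁅_⁆) renaming (_∈_ to _∈ₛ_; _⊆_ to _⊆ₛ_)
open import Data.Fin.Subset.Properties using (_∈?_; x∈⁅x⁆)
open import Data.List.Base using (List; []; _∷_; map; filter; allFin)
open import Data.List.Membership.Propositional using (_∈_)
open import Data.List.Membership.Propositional.Properties using (∈-filter⁺; ∈-filter⁻; ∈-allFin)
open import Data.List.Relation.Unary.All as All using (All; []; _∷_)
import Data.List.Relation.Unary.All.Properties as All
open import Data.Nat.Base using (ℕ; zero; suc)
open import Data.Product.Base using (_×_; _,_; proj₂; ∃-syntax)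
open import Function.Bundles using (_⇔_; mk⇔; Equivalence)
open import Level using (0ℓ)
open import Relation.Binary.PropositionalEquality using (_≡_)
open import Relation.Nullary using (¬_)
open import Relation.Nullary.Decidable using (decidable-stable)
open import Relation.Unary using (Pred; _≐_) renaming (_⊆_ to _⊆ₚ_)

-- There are n agents, represented by Fin n; atoms are natural numbers.

variable
  n : ℕ

-- Irrelevance of the nonemptiness proof makes two groups with the same
-- members equal, so that C[ G ] φ does not depend on a choice of member.

record Group (n : ℕ) : Set where
  constructor group
  field
    members   : Subset n
    .nonempty : Nonempty members

open Group public using (members)

_∈ᵍ_ : Fin n → Group n → Set
a ∈ᵍ G = a ∈ₛ members G

_⊆ᵍ_ : Group n → Group n → Set
G ⊆ᵍ H = members G ⊆ₛ members H

⟨_⟩ : Fin n → Group n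
⟨ a ⟩ = group ⁅ a ⁆ (a , x∈⁅x⁆ a)

toList : Group n → List (Fin n)
toList {n} G = filter (_∈? members G) (allFin n)

infix  30 `_
infix  25 ¬̇_ K[_]_ C[_]_ D[_]_
infixr 22 _∧̇_
infixr 20 _⇒_
infix  19 _⇔̇_

-- The two flags say whether C_G, respectively D_G, belongs to the
-- language.

data Form (n : ℕ) : (hasC hasD : Bool) → Set where
  `_    : ∀ {c d} → ℕ → Form n c d
  ¬̇_    : ∀ {c d} → Form n c d → Form n c d
  _⇒_   : ∀ {c d} → Form n c d → Form n c d → Form n c d
  K[_]_ : ∀ {c d} → Fin n → Form n c d → Form n c d
  C[_]_ : ∀ {d} → Group n → Form n true d → Form n true d
  D[_]_ : ∀ {c} → Group n → Form n c true → Form n c true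

EL ELC ELD ELCD : ℕ → Set
EL   n = Form n false false
ELC  n = Form n true  false
ELD  n = Form n false true
ELCD n = Form n true  true

variable
  c d : Bool

_∧̇_ : Form n c d → Form n c d → Form n c d
φ ∧̇ ψ = ¬̇ (φ ⇒ ¬̇ ψ)

_⇔̇_ : Form n c d → Form n c d → Form n c d
φ ⇔̇ ψ = (φ ⇒ ψ) ∧̇ (ψ ⇒ φ)

⊤̇ : Form n c d
⊤̇ = ` 0 ⇒ ` 0

⋀ : List (Form n c d) → Form n c d
⋀ []             = ⊤̇
⋀ (φ ∷ [])       = φ
⋀ (φ ∷ ψ ∷ φs)   = φ ∧̇ ⋀ (ψ ∷ φs)

E[_]_ : Group n → Form n c d → Form n c d
E[ G ] φ = ⋀ (map (λ a → K[ a ] φ) (toList G))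

-- E^[1+ k ] G φ is E_G^{k+1} φ, so that k ranges over all exponents ≥ 1.

E^[1+_] : ℕ → Group n → Form n c d → Form n c d
E^[1+ zero  ] G φ = E[ G ] φ
E^[1+ suc k ] G φ = E[ G ] (E^[1+ k ] G φ)

record Model (n : ℕ) : Set₁ where
  field
    W         : Set
    inhabited : W
    A         : Set
    E         : W → W → Pred A 0ℓ
    C         : Fin n → Pred A 0ℓ
    ν         : W → Pred ℕ 0ℓ

  ⋃C : Group n → Pred A 0ℓ
  ⋃C G x = ∃[ a ] (a ∈ᵍ G × C a x)

  Everyone : Group n → Pred W 0ℓ → Pred W 0ℓ
  Everyone G X s = ∀ a → a ∈ᵍ G → ∀ t → C a ⊆ₚ E s t → X t

  Everyone^[1+_] : ℕ → Group n → Pred W 0ℓ → Pred W 0ℓ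
  Everyone^[1+ zero  ] G X = Everyone G X
  Everyone^[1+ suc k ] G X = Everyone G (Everyone^[1+ k ] G X)

Symmetric : Model n → Set
Symmetric M = ∀ s t → E s t ≐ E t s
  where open Model M

infix 4 _,_⊨_ _⊨_ _⊨ˢʸᵐ_ _⊢_

-- Structural recursion does not allow the clause for C_G to mention the
-- formulas E_G^{k+1} φ; it uses the operator they denote instead.  See
-- ⊨C⇔ for the agreement of the two.

_,_⊨_ : (M : Model n) → Model.W M → Form n c d → Set
M , s ⊨ ` p      = Model.ν M s p
M , s ⊨ ¬̇ φ      = ¬ (M , s ⊨ φ)
M , s ⊨ φ ⇒ ψ    = M , s ⊨ φ → M , s ⊨ ψ
M , s ⊨ K[ a ] φ = ∀ t → Model.C M a ⊆ₚ Model.E M s t → M , t ⊨ φ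
M , s ⊨ C[ G ] φ = ∀ k → Model.Everyone^[1+_] M k G (λ t → M , t ⊨ φ) s
M , s ⊨ D[ G ] φ = ∀ t → Model.⋃C M G ⊆ₚ Model.E M s t → M , t ⊨ φ

Valid : Form n c d → Set₁
Valid φ = ∀ M s → M , s ⊨ φ

_⊨_ : Pred (Form n c d) 0ℓ → Form n c d → Set₁
Φ ⊨ φ = ∀ M s → (∀ ψ → Φ ψ → M , s ⊨ ψ) → M , s ⊨ φ

_⊨ˢʸᵐ_ : Pred (Form n c d) 0ℓ → Form n c d → Set₁
Φ ⊨ˢʸᵐ φ = ∀ M → Symmetric M → ∀ s → (∀ ψ → Φ ψ → M , s ⊨ ψ) → M , s ⊨ φ

module _ (em : ExcludedMiddle 0ℓ) (M : Model n) where

  open Model M using (E; C; Everyone; Everyone^[1+_])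
  open Equivalence using (to; from)

  ⊨⋀⇔ : ∀ s (φs : List (Form n c d)) → M , s ⊨ ⋀ φs ⇔ All (M , s ⊨_) φs
  ⊨⋀⇔ s []           = mk⇔ (λ _ → []) (λ _ x → x)
  ⊨⋀⇔ s (φ ∷ [])     = mk⇔ (_∷ []) All.head
  ⊨⋀⇔ s (φ ∷ ψ ∷ φs) =
    let rest = ⊨⋀⇔ s (ψ ∷ φs) in mk⇔
    (λ h → decidable-stable em (λ ¬x → h (λ x _ → ¬x x))
         ∷ to rest (decidable-stable em (λ ¬y → h (λ _ → ¬y))))
    (λ xs h → h (All.head xs) (from rest (All.tail xs)))

  ⊨E⇔ : ∀ s G (φ : Form n c d) →
        M , s ⊨ E[ G ] φ ⇔ Everyone G (λ t → M , t ⊨ φ) s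
  ⊨E⇔ s G φ = mk⇔
    (λ h a a∈G → All.lookup (All.map⁻ (to eq h)) (∈-filter⁺ (_∈? members G) (∈-allFin a) a∈G))
    (λ h → from eq (All.map⁺ (All.tabulate λ {a} a∈ →
      h a (proj₂ (∈-filter⁻ (_∈? members G) {xs = allFin n} a∈)))))
    where eq = ⊨⋀⇔ s (map (λ a → K[ a ] φ) (toList G))

  ⊨E^⇔ : ∀ s k G (φ : Form n c d) →
         M , s ⊨ E^[1+ k ] G φ ⇔ Everyone^[1+ k ] G (λ t → M , t ⊨ φ) s
  ⊨E^⇔ s zero    G φ = ⊨E⇔ s G φ
  ⊨E^⇔ s (suc k) G φ = mk⇔
    (λ h a a∈G t (st : C a ⊆ₚ E s t) → to (⊨E^⇔ t k G φ) (to E⇔ h a a∈G t st))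
    (λ h → from E⇔ λ a a∈G t (st : C a ⊆ₚ E s t) → from (⊨E^⇔ t k G φ) (h a a∈G t st))
    where E⇔ = ⊨E⇔ s G (E^[1+ k ] G φ)

  ⊨C⇔ : ∀ s G (φ : Form n true d) →
        M , s ⊨ C[ G ] φ ⇔ (∀ k → M , s ⊨ E^[1+ k ] G φ)
  ⊨C⇔ s G φ = mk⇔ (λ h k → from (⊨E^⇔ s k G φ) (h k)) (λ h k → to (⊨E^⇔ s k G φ) (h k))

data PropForm : Set where
  var : ℕ → PropForm
  neg : PropForm → PropForm
  imp : PropForm → PropForm → PropForm

eval : (ℕ → Bool) → PropForm → Bool
eval v (var i)   = v i
eval v (neg τ)   = not (eval v τ)
eval v (imp τ υ) = not (eval v τ) ∨ eval v υ

Tautology : PropForm → Set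
Tautology τ = ∀ v → eval v τ ≡ true

inst : (ℕ → Form n c d) → PropForm → Form n c d
inst σ (var i)   = σ i
inst σ (neg τ)   = ¬̇ inst σ τ
inst σ (imp τ υ) = inst σ τ ⇒ inst σ υ

data Logic : (hasC hasD : Bool) → Set where
  𝐊 𝐊𝐁 : Logic false false
  𝐊𝐂   : Logic true  false
  𝐊𝐃   : Logic false true
  𝐊𝐂𝐃  : Logic true  true

-- The indices of Logic restrict the rules for C_G to 𝐊𝐂 and 𝐊𝐂𝐃, and
-- those for D_G to 𝐊𝐃 and 𝐊𝐂𝐃.

data _⊢_ {n : ℕ} : {c d : Bool} → Logic c d → Form n c d → Set where
  taut  : ∀ {c d} {Λ : Logic c d} (τ : PropForm) → Tautology τ →
          (σ : ℕ → Form n c d) → Λ ⊢ inst σ τ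
  mp    : ∀ {c d} {Λ : Logic c d} {φ ψ : Form n c d} →
          Λ ⊢ φ → Λ ⊢ φ ⇒ ψ → Λ ⊢ ψ
  K-dist : ∀ {c d} {Λ : Logic c d} (a : Fin n) (φ ψ : Form n c d) →
          Λ ⊢ K[ a ] (φ ⇒ ψ) ⇒ K[ a ] φ ⇒ K[ a ] ψ
  K-nec : ∀ {c d} {Λ : Logic c d} (a : Fin n) {φ : Form n c d} →
          Λ ⊢ φ → Λ ⊢ K[ a ] φ
  B     : (a : Fin n) (φ : EL n) → 𝐊𝐁 ⊢ φ ⇒ K[ a ] ¬̇ K[ a ] ¬̇ φ
  C-mix : ∀ {d} {Λ : Logic true d} (G : Group n) (φ : Form n true d) →
          Λ ⊢ C[ G ] φ ⇒ E[ G ] (φ ∧̇ C[ G ] φ)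
  C-ind : ∀ {d} {Λ : Logic true d} (G : Group n) {φ ψ : Form n true d} →
          Λ ⊢ φ ⇒ E[ G ] (φ ∧̇ ψ) → Λ ⊢ φ ⇒ C[ G ] ψ
  D-dist : ∀ {c} {Λ : Logic c true} (G : Group n) (φ ψ : Form n c true) →
          Λ ⊢ D[ G ] (φ ⇒ ψ) ⇒ D[ G ] φ ⇒ D[ G ] ψ
  D-single : ∀ {c} {Λ : Logic c true} (a : Fin n) (φ : Form n c true) →
          Λ ⊢ D[ ⟨ a ⟩ ] φ ⇔̇ K[ a ] φ
  D-mono : ∀ {c} {Λ : Logic c true} (G H : Group n) (φ : Form n c true) →
          G ⊆ᵍ H → Λ ⊢ D[ G ] φ ⇒ D[ H ] φ

infix 4 _⊢[_]_

_⊢[_]_ : Pred (Form n c d) 0ℓ → Logic c d → Form n c d → Set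
Φ ⊢[ Λ ] φ = ∃[ Φ₀ ] (All Φ Φ₀ × Λ ⊢ ⋀ Φ₀ ⇒ φ)

{-# OPTIONS --safe #-}
module Submission where

-- Maximal consistent sets are Bool-valued, so that they form a small type.
-- The canonical model takes agents as skills and uses the smallest
-- filtration of the canonical relations through a set Σ of formulas: all
-- formulas for strong completeness, the subformulas of φ for weak
-- completeness.  If Σ is finite, every Σ-invariant set of worlds is defined
-- by a formula; the one defining the worlds at which ψ is commonly known is
-- an invariant to which the induction rule for C applies.  For D, worlds
-- carry the group through whose relation they were entered.  Under axiom B
-- the canonical relations, hence their filtrations, are symmetric.

open import Defs
open import Axiom.ExcludedMiddle using (ExcludedMiddle)
open import Data.Bool.Base using (Bool; true; false; T)
open import Data.Bool.Properties using (T?)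
import Data.Empty.Irrelevant as Irrelevant
open import Data.Fin.Base using (Fin; zero)
open import Data.Fin.Subset using (Subset; Nonempty; inside; outside)
open import Data.Fin.Subset.Properties using (_∈?_; x∈⁅x⁆; x∈⁅y⁆⇒x≡y; nonempty?)
open import Data.List.Base
  using (List; []; _∷_; _++_; map; concat; concatMap; foldl; upTo; allFin; cartesianProductWith)
open import Data.List.Membership.Propositional using (_∈_)
open import Data.List.Membership.Propositional.Properties
  using (∈-++⁺ˡ; ∈-++⁺ʳ; ∈-++⁻; ∈-map⁺; ∈-upTo⁺; ∈-allFin; ∈-filter⁺; ∈-filter⁻
        ; ∈-concat⁺′; ∈-concatMap⁺; ∈-cartesianProductWith⁺)
open import Data.List.Relation.Unary.All as All using (All; []; _∷_)
import Data.List.Relation.Unary.All.Properties as All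
open import Data.List.Relation.Unary.Any using (here; there)
import Data.List.Relation.Unary.Any as Any
open import Data.Nat.Base using (ℕ; zero; suc; _+_; _⊔_; _≤_; s≤s; NonZero)
open import Data.Nat.Properties using (≤-refl; ≤-trans; m≤m⊔n; m≤n⊔m; +-comm)
open import Data.Product.Base using (_×_; _,_; proj₁; proj₂; ∃-syntax)
open import Data.Sum.Base using (_⊎_; inj₁; inj₂; [_,_])
open import Data.Unit.Base using (tt)
open import Data.Vec.Base using ([]; _∷_)
open import Function.Base using (_∘_; id)
open import Function.Bundles using (_⇔_; mk⇔; Equivalence)
open import Level using (0ℓ)
open import Relation.Binary.PropositionalEquality using (_≡_; refl; sym; trans; subst)
open import Relation.Nullary using (¬_; yes; no; contradiction)
open import Relation.Nullary.Decidable using (⌊_⌋; toWitness; fromWitness; decidable-stable; recompute)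
open import Relation.Unary using (Pred; _∪_; ｛_｝; _⊆_; U; ∅)

open Equivalence using (to; from)

-- Finite lists of groups and of formulas.

member : (G : Group n) → Nonempty (members G)
member (group p ne) = recompute (nonempty? p) ne

subsets : ∀ n → List (Subset n)
subsets zero    = [] ∷ []
subsets (suc n) = map (inside ∷_) (subsets n) ++ map (outside ∷_) (subsets n)

∈-subsets : (p : Subset n) → p ∈ subsets n
∈-subsets []                  = here refl
∈-subsets (true ∷ p)          = ∈-++⁺ˡ (∈-map⁺ (inside ∷_) (∈-subsets p))
∈-subsets {suc n} (false ∷ p) = ∈-++⁺ʳ (map (inside ∷_) (subsets n)) (∈-map⁺ (outside ∷_) (∈-subsets p))

groupsOn : Subset n → List (Group n)
groupsOn p with nonempty? p
... | yes ne = group p ne ∷ []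
... | no  _  = []

∈-groupsOn : (G : Group n) → G ∈ groupsOn (members G)
∈-groupsOn (group p ne) with nonempty? p
-- The witness found may differ from `ne`, but the field is irrelevant, so both give the same group.
... | yes _  = here refl
... | no ¬ne = Irrelevant.⊥-elim (¬ne ne)

groups : ∀ n → List (Group n)
groups n = concatMap groupsOn (subsets n)

∈-groups : (G : Group n) → G ∈ groups n
∈-groups G = ∈-concatMap⁺ groupsOn (Any.map (λ { refl → ∈-groupsOn G }) (∈-subsets (members G)))

-- Countability of the language: every formula occurs in one of the finite
-- lists formulas 0, formulas 1, ….

Cs : ∀ {c d} → List (Form n c d) → List (Form n c d)
Cs {c = false} _  = []
Cs {c = true}  φs = cartesianProductWith C[_]_ (groups _) φs

Ds : ∀ {c d} → List (Form n c d) → List (Form n c d)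
Ds {d = false} _  = []
Ds {d = true}  φs = cartesianProductWith D[_]_ (groups _) φs

mutual
  formulas : ℕ → List (Form n c d)
  formulas zero    = []
  formulas (suc k) = concat (layers k)

  layers : ℕ → List (List (Form n c d))
  layers k = map `_ (upTo k) ∷ map ¬̇_ φs ∷ cartesianProductWith _⇒_ φs φs
           ∷ cartesianProductWith K[_]_ (allFin _) φs ∷ Cs φs ∷ Ds φs ∷ []
    where φs = formulas k

rank : Form n c d → ℕ
-- `formulas (suc k)` contains only the atoms below `k`, hence two successors.
rank (` p)      = suc (suc p)
rank (¬̇ φ)      = suc (rank φ)
rank (φ ⇒ ψ)    = suc (rank φ ⊔ rank ψ)
rank (K[ a ] φ) = suc (rank φ)
rank (C[ G ] φ) = suc (rank φ)
rank (D[ G ] φ) = suc (rank φ)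

∈-formulas : (φ : Form n c d) {k : ℕ} → rank φ ≤ k → φ ∈ formulas k
∈-formulas (` p) {suc k} (s≤s p<k) =
  ∈-concat⁺′ {xss = layers k} (∈-map⁺ `_ (∈-upTo⁺ p<k)) (here refl)
∈-formulas (¬̇ φ) {suc k} (s≤s r≤k) =
  ∈-concat⁺′ {xss = layers k} (∈-map⁺ ¬̇_ (∈-formulas φ r≤k)) (there (here refl))
∈-formulas (φ ⇒ ψ) {suc k} (s≤s r≤k) =
  ∈-concat⁺′ {xss = layers k}
    (∈-cartesianProductWith⁺ _⇒_ (∈-formulas φ (≤-trans (m≤m⊔n _ _) r≤k))
                                 (∈-formulas ψ (≤-trans (m≤n⊔m (rank φ) _) r≤k)))
    (there (there (here refl)))
∈-formulas (K[ a ] φ) {suc k} (s≤s r≤k) =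
  ∈-concat⁺′ {xss = layers k}
    (∈-cartesianProductWith⁺ K[_]_ (∈-allFin a) (∈-formulas φ r≤k))
    (there (there (there (here refl))))
∈-formulas (C[ G ] φ) {suc k} (s≤s r≤k) =
  ∈-concat⁺′ {xss = layers k}
    (∈-cartesianProductWith⁺ C[_]_ (∈-groups G) (∈-formulas φ r≤k))
    (there (there (there (there (here refl)))))
∈-formulas (D[ G ] φ) {suc k} (s≤s r≤k) =
  ∈-concat⁺′ {xss = layers k}
    (∈-cartesianProductWith⁺ D[_]_ (∈-groups G) (∈-formulas φ r≤k))
    (there (there (there (there (there (here refl))))))

-- Subformulas.

infix 4 _⊲_

data _⊲_ {n : ℕ} : {c d : Bool} → Form n c d → Form n c d → Set where
  ¬-arg : ∀ {c d} {φ : Form n c d} → φ ⊲ ¬̇ φ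
  ⇒-lhs : ∀ {c d} {φ ψ : Form n c d} → φ ⊲ φ ⇒ ψ
  ⇒-rhs : ∀ {c d} {φ ψ : Form n c d} → ψ ⊲ φ ⇒ ψ
  K-arg : ∀ {c d a} {φ : Form n c d} → φ ⊲ K[ a ] φ
  C-arg : ∀ {d G} {φ : Form n true d} → φ ⊲ C[ G ] φ
  D-arg : ∀ {c G} {φ : Form n c true} → φ ⊲ D[ G ] φ

SubformulaClosed : Pred (Form n c d) 0ℓ → Set
SubformulaClosed Σ = ∀ {φ ψ} → φ ⊲ ψ → Σ ψ → Σ φ

mutual
  subformulas : Form n c d → List (Form n c d)
  subformulas φ = φ ∷ proper φ

  proper : Form n c d → List (Form n c d)
  proper (` p)      = []
  proper (¬̇ φ)      = subformulas φ
  proper (φ ⇒ ψ)    = subformulas φ ++ subformulas ψ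
  proper (K[ a ] φ) = subformulas φ
  proper (C[ G ] φ) = subformulas φ
  proper (D[ G ] φ) = subformulas φ

mutual
  subformulas-closed : (φ : Form n c d) → SubformulaClosed (_∈ subformulas φ)
  subformulas-closed φ       i (there p)   = there (proper-closed φ i p)
  subformulas-closed (φ ⇒ ψ) ⇒-rhs (here refl) = there (∈-++⁺ʳ (subformulas φ) (here refl))
  subformulas-closed _       ¬-arg (here refl) = there (here refl)
  subformulas-closed _       ⇒-lhs (here refl) = there (here refl)
  subformulas-closed _       K-arg (here refl) = there (here refl)
  subformulas-closed _       C-arg (here refl) = there (here refl)
  subformulas-closed _       D-arg (here refl) = there (here refl)

  proper-closed : (φ : Form n c d) → SubformulaClosed (_∈ proper φ)
  proper-closed (¬̇ φ)      i p = subformulas-closed φ i p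
  proper-closed (φ ⇒ ψ)    i p with ∈-++⁻ (subformulas φ) p
  ... | inj₁ q = ∈-++⁺ˡ (subformulas-closed φ i q)
  ... | inj₂ q = ∈-++⁺ʳ (subformulas φ) (subformulas-closed ψ i q)
  proper-closed (K[ a ] φ) i p = subformulas-closed φ i p
  proper-closed (C[ G ] φ) i p = subformulas-closed φ i p
  proper-closed (D[ G ] φ) i p = subformulas-closed φ i p

-- Propositional theorems.

module _ {n : ℕ} {c d : Bool} {Λ : Logic c d} where

  private
    schema : Form n c d → Form n c d → Form n c d → ℕ → Form n c d
    schema φ ψ χ 0 = φ
    schema φ ψ χ 1 = ψ
    schema φ ψ χ _ = χ

  -- The first two tautologies give the deduction theorem, the last two Lindenbaum's lemma. Later
  -- propositional reasoning takes place at worlds, through `everywhere⇒⊢`.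
  weakening : ∀ φ ψ → Λ ⊢ φ ⇒ ψ ⇒ φ
  weakening φ ψ = taut τ valid (schema φ ψ ψ)
    where
    τ = imp (var 0) (imp (var 1) (var 0))

    valid : Tautology τ
    valid v with v 0 | v 1
    ... | true  | true  = refl
    ... | true  | false = refl
    ... | false | _     = refl

  distribution : ∀ φ ψ χ → Λ ⊢ (φ ⇒ ψ ⇒ χ) ⇒ (φ ⇒ ψ) ⇒ φ ⇒ χ
  distribution φ ψ χ = taut τ valid (schema φ ψ χ)
    where
    τ = imp (imp (var 0) (imp (var 1) (var 2))) (imp (imp (var 0) (var 1)) (imp (var 0) (var 2)))

    valid : Tautology τ
    valid v with v 0 | v 1 | v 2
    ... | false | _     | _     = refl
    ... | true  | false | _     = refl
    ... | true  | true  | true  = refl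
    ... | true  | true  | false = refl

  explosion : ∀ φ ψ → Λ ⊢ ¬̇ φ ⇒ φ ⇒ ψ
  explosion φ ψ = taut τ valid (schema φ ψ ψ)
    where
    τ = imp (neg (var 0)) (imp (var 0) (var 1))

    valid : Tautology τ
    valid v with v 0
    ... | true  = refl
    ... | false = refl

  dichotomy : ∀ φ ψ → Λ ⊢ (φ ⇒ ψ) ⇒ (¬̇ φ ⇒ ψ) ⇒ ψ
  dichotomy φ ψ = taut τ valid (schema φ ψ ψ)
    where
    τ = imp (imp (var 0) (var 1)) (imp (imp (neg (var 0)) (var 1)) (var 1))

    valid : Tautology τ
    valid v with v 0 | v 1
    ... | true  | true  = refl
    ... | true  | false = refl
    ... | false | true  = refl
    ... | false | false = refl

-- Lets conditions on D[ G ] φ be stated for every language, including those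
-- without D, where they are vacuous.

data IsD {n : ℕ} : {c d : Bool} → Group n → Form n c d → Form n c d → Set where
  isD : ∀ {c} G (φ : Form n c true) → IsD G (D[ G ] φ) φ

-- Derivations from hypotheses, and maximal consistent sets.

module Worlds (em : ExcludedMiddle 0ℓ) {n : ℕ} {c d : Bool} (Λ : Logic c d) where

  private
    Fm : Set
    Fm = Form n c d

  infix 4 _⊩_ _∋_ _⟶[_]_

  -- Necessitation reaches theorems only, through `thm`; this is what makes `deduction` hold.
  data _⊩_ (Γ : Pred Fm 0ℓ) : Fm → Set where
    hyp : ∀ {φ} → Γ φ → Γ ⊩ φ
    thm : ∀ {φ} → Λ ⊢ φ → Γ ⊩ φ
    app : ∀ {φ ψ} → Γ ⊩ φ ⇒ ψ → Γ ⊩ φ → Γ ⊩ ψ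

  ⊩-mono : ∀ {Γ Δ φ} → Γ ⊆ Δ → Γ ⊩ φ → Δ ⊩ φ
  ⊩-mono i (hyp x)   = hyp (i x)
  ⊩-mono i (thm x)   = thm x
  ⊩-mono i (app f x) = app (⊩-mono i f) (⊩-mono i x)

  deduction : ∀ {Γ χ φ} → (Γ ∪ ｛ χ ｝) ⊩ φ → Γ ⊩ χ ⇒ φ
  deduction         (hyp (inj₁ x))    = app (thm (weakening _ _)) (hyp x)
  -- The identity `χ ⇒ χ` as the combinator term S K K.
  deduction {χ = χ} (hyp (inj₂ refl)) =
    app (app (thm (distribution _ (χ ⇒ χ) _)) (thm (weakening _ _))) (thm (weakening _ _))
  deduction         (thm x)           = app (thm (weakening _ _)) (thm x)
  deduction         (app f x)         = app (app (thm (distribution _ _ _)) (deduction f)) (deduction x)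

  ⊩⇒⊢ : ∀ {φ} → ∅ ⊩ φ → Λ ⊢ φ
  ⊩⇒⊢ (thm x)   = x
  ⊩⇒⊢ (app f x) = mp (⊩⇒⊢ x) (⊩⇒⊢ f)

  record World : Set where
    no-eta-equality
    field
      holds : Fm → Bool
      neg⇔  : ∀ {φ} → T (holds (¬̇ φ)) ⇔ (¬ T (holds φ))
      imp⇔  : ∀ {φ ψ} → T (holds (φ ⇒ ψ)) ⇔ (T (holds φ) → T (holds ψ))
      sound : ∀ {φ} → Λ ⊢ φ → T (holds φ)

  open World public

  _∋_ : World → Fm → Set
  s ∋ φ = T (holds s φ)

  ∋-stable : ∀ s {φ} → ¬ ¬ (s ∋ φ) → s ∋ φ
  ∋-stable _ = decidable-stable (T? _)

  -- Lindenbaum's lemma, relative to a formula `φ₀` not to be derived.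

  module _ (φ₀ : Fm) where

    -- The test for admitting `χ` is part of the predicate, so excluded middle enters only the
    -- proofs about it.
    extend : Pred Fm 0ℓ → Fm → Pred Fm 0ℓ
    extend Γ χ ψ = Γ ψ ⊎ (χ ≡ ψ × ¬ ((Γ ∪ ｛ χ ｝) ⊩ φ₀))

    extend-⊮ : ∀ Γ χ → ¬ (Γ ⊩ φ₀) → ¬ (extend Γ χ ⊩ φ₀)
    extend-⊮ Γ χ Γ⊮ ext⊩ with em {(Γ ∪ ｛ χ ｝) ⊩ φ₀}
    ... | yes Γχ⊩ = Γ⊮ (⊩-mono [ id , (λ (_ , Γχ⊮) → contradiction Γχ⊩ Γχ⊮) ] ext⊩)
    ... | no  Γχ⊮ = Γχ⊮ (⊩-mono [ inj₁ , inj₂ ∘ proj₁ ] ext⊩)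

    extend*-⊮ : ∀ Γ χs → ¬ (Γ ⊩ φ₀) → ¬ (foldl extend Γ χs ⊩ φ₀)
    extend*-⊮ Γ []       Γ⊮ = Γ⊮
    extend*-⊮ Γ (χ ∷ χs) Γ⊮ = extend*-⊮ (extend Γ χ) χs (extend-⊮ Γ χ Γ⊮)

    extend*-⊇ : ∀ Γ χs → Γ ⊆ foldl extend Γ χs
    extend*-⊇ Γ []       x = x
    extend*-⊇ Γ (χ ∷ χs) x = extend*-⊇ (extend Γ χ) χs (inj₁ x)

    -- A rejected formula leaves behind a derivation of `χ ⇒ φ₀`, which, unlike its absence, is
    -- preserved by later extensions.
    extend*-decides : ∀ Γ {χ χs} → χ ∈ χs → foldl extend Γ χs χ ⊎ (foldl extend Γ χs ⊩ χ ⇒ φ₀)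
    extend*-decides Γ {χ} {χs = _ ∷ χs} (here refl) with em {(Γ ∪ ｛ χ ｝) ⊩ φ₀}
    ... | yes Γχ⊩ = inj₂ (⊩-mono (extend*-⊇ (extend Γ χ) χs ∘ inj₁) (deduction Γχ⊩))
    ... | no  Γχ⊮ = inj₁ (extend*-⊇ (extend Γ χ) χs (inj₂ (refl , Γχ⊮)))
    extend*-decides Γ {χs = ψ ∷ _} (there p) = extend*-decides (extend Γ ψ) p

    module Lindenbaum (Γ : Pred Fm 0ℓ) (Γ⊮ : ¬ (Γ ⊩ φ₀)) where

      stage : ℕ → Pred Fm 0ℓ
      stage zero    = Γ
      stage (suc k) = foldl extend (stage k) (formulas k)

      limit : Pred Fm 0ℓ
      limit φ = ∃[ k ] stage k φ

      stage-⊮ : ∀ k → ¬ (stage k ⊩ φ₀)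
      stage-⊮ zero    = Γ⊮
      stage-⊮ (suc k) = extend*-⊮ (stage k) (formulas k) (stage-⊮ k)

      stage-mono : ∀ j k → stage k ⊆ stage (j + k)
      stage-mono zero    k x = x
      stage-mono (suc j) k x = extend*-⊇ (stage (j + k)) (formulas (j + k)) (stage-mono j k x)

      limit-compact : ∀ {φ} → limit ⊩ φ → ∃[ k ] (stage k ⊩ φ)
      limit-compact (hyp (k , x)) = k , hyp x
      limit-compact (thm x)       = 0 , thm x
      limit-compact (app f x) with limit-compact f | limit-compact x
      ... | j , f′ | k , x′ =
        j + k , app (⊩-mono (subst (λ m → stage j ⊆ stage m) (+-comm k j) (stage-mono k j)) f′)
                    (⊩-mono (stage-mono j k) x′)

      limit-⊮ : ¬ (limit ⊩ φ₀)
      limit-⊮ p = let k , q = limit-compact p in stage-⊮ k q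

      limit-decides : ∀ χ → limit χ ⊎ (limit ⊩ χ ⇒ φ₀)
      -- `χ` is listed in `formulas (rank χ)`, hence decided in passing to the next stage.
      limit-decides χ with extend*-decides (stage (rank χ)) (∈-formulas χ ≤-refl)
      ... | inj₁ x = inj₁ (suc (rank χ) , x)
      ... | inj₂ p = inj₂ (⊩-mono (suc (rank χ) ,_) p)

      limit-closed : ∀ {χ} → limit ⊩ χ → limit χ
      limit-closed {χ} p with limit-decides χ
      ... | inj₁ x = x
      ... | inj₂ q = contradiction (app q p) limit-⊮

      limit-consistent : ∀ {χ} → limit (¬̇ χ) → ¬ limit χ
      limit-consistent x y = limit-⊮ (app (app (thm (explosion _ φ₀)) (hyp x)) (hyp y))

      limit-complete : ∀ {χ} → ¬ limit χ → limit (¬̇ χ)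
      limit-complete {χ} ¬x with limit-decides χ | limit-decides (¬̇ χ)
      ... | inj₁ x | _      = contradiction x ¬x
      ... | inj₂ _ | inj₁ x = x
      ... | inj₂ p | inj₂ q = contradiction (app (app (thm (dichotomy χ φ₀)) p) q) limit-⊮

      limit-imp : ∀ {χ ψ} → (limit χ → limit ψ) → limit (χ ⇒ ψ)
      limit-imp {χ} {ψ} f with em {limit χ}
      ... | yes x = limit-closed (app (thm (weakening ψ χ)) (hyp (f x)))
      ... | no ¬x = limit-closed (app (thm (explosion χ ψ)) (hyp (limit-complete ¬x)))

      world : World
      world = record
        { holds = λ φ → ⌊ em {limit φ} ⌋
        ; neg⇔  = mk⇔ (λ x y → limit-consistent (toWitness x) (toWitness y))
                      (λ ¬x → fromWitness (limit-complete (¬x ∘ fromWitness)))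
        ; imp⇔  = mk⇔ (λ f x → fromWitness (limit-closed (app (hyp (toWitness f)) (hyp (toWitness x)))))
                      (λ f → fromWitness (limit-imp (toWitness ∘ f ∘ fromWitness)))
        ; sound = fromWitness ∘ limit-closed ∘ thm
        }

  lindenbaum : ∀ {Γ φ} → ¬ (Γ ⊩ φ) → ∃[ s ] ((∀ {ψ} → Γ ψ → s ∋ ψ) × ¬ (s ∋ φ))
  lindenbaum {Γ} {φ} Γ⊮ =
    world , (λ x → fromWitness (0 , x)) , (λ x → limit-⊮ (hyp (toWitness x)))
    where open Lindenbaum φ Γ Γ⊮

  -- Reasoning at worlds.

  -- Lindenbaum's lemma without hypotheses. It lets theorems be proved by an argument at an
  -- arbitrary world instead of a formal derivation.
  everywhere⇒⊢ : ∀ {φ} → (∀ s → s ∋ φ) → Λ ⊢ φ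
  everywhere⇒⊢ {φ} all with em {∅ ⊩ φ}
  ... | yes p = ⊩⇒⊢ p
  ... | no ¬p = let s , _ , ¬x = lindenbaum ¬p in contradiction (all s) ¬x

  ∋-mp : ∀ s {φ ψ} → Λ ⊢ φ ⇒ ψ → s ∋ φ → s ∋ ψ
  ∋-mp s p = to (imp⇔ s) (sound s p)

  ∋-∧⇔ : ∀ s {φ ψ} → s ∋ φ ∧̇ ψ ⇔ (s ∋ φ × s ∋ ψ)
  ∋-∧⇔ s = mk⇔
    (λ h → ∋-stable s (λ ¬x → to (neg⇔ s) h (from (imp⇔ s) (λ x → contradiction x ¬x)))
         , ∋-stable s (λ ¬y → to (neg⇔ s) h (from (imp⇔ s) (λ _ → from (neg⇔ s) ¬y))))
    (λ (x , y) → from (neg⇔ s) (λ h → to (neg⇔ s) (to (imp⇔ s) h x) y))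

  ∋-⊤ : ∀ s → s ∋ ⊤̇
  ∋-⊤ s = from (imp⇔ s) id

  ∋-⋀⇔ : ∀ s φs → s ∋ ⋀ φs ⇔ All (s ∋_) φs
  ∋-⋀⇔ s []           = mk⇔ (λ _ → []) (λ _ → ∋-⊤ s)
  ∋-⋀⇔ s (φ ∷ [])     = mk⇔ (_∷ []) All.head
  ∋-⋀⇔ s (φ ∷ ψ ∷ φs) = mk⇔
    (λ h → let x , y = to (∋-∧⇔ s) h in x ∷ to (∋-⋀⇔ s (ψ ∷ φs)) y)
    (λ xs → from (∋-∧⇔ s) (All.head xs , from (∋-⋀⇔ s (ψ ∷ φs)) (All.tail xs)))

  ∋-E⇔ : ∀ s G {φ} → s ∋ E[ G ] φ ⇔ (∀ a → a ∈ᵍ G → s ∋ K[ a ] φ)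
  ∋-E⇔ s G = mk⇔
    (λ h a a∈G → All.lookup (All.map⁻ (to (∋-⋀⇔ s _) h)) (∈-filter⁺ (_∈? members G) (∈-allFin a) a∈G))
    (λ h → from (∋-⋀⇔ s _) (All.map⁺ (All.tabulate λ {a} a∈ →
      h a (proj₂ (∈-filter⁻ (_∈? members G) {xs = allFin n} a∈)))))

  -- Only the finite list of hypotheses is read off the derivation; the implication from their
  -- conjunction is checked at worlds.
  ⊩-finite : ∀ {Γ φ} → Γ ⊩ φ → Γ ⊢[ Λ ] φ
  ⊩-finite p = let L , L⊆Γ , f = support p in L , L⊆Γ , everywhere⇒⊢ λ s →
    from (imp⇔ s) (λ x → f s (to (∋-⋀⇔ s L) x))
    where
    support : ∀ {Γ φ} → Γ ⊩ φ → ∃[ L ] (All Γ L × ∀ s → All (s ∋_) L → s ∋ φ)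
    support (hyp x)   = _ ∷ [] , x ∷ [] , λ _ → All.head
    support (thm x)   = [] , [] , λ s _ → sound s x
    support (app f x) with support f | support x
    ... | L , L⊆Γ , f′ | L′ , L′⊆Γ , x′ = L ++ L′ , All.++⁺ L⊆Γ L′⊆Γ ,
      λ s ys → to (imp⇔ s) (f′ s (All.++⁻ˡ L ys)) (x′ s (All.++⁻ʳ L ys))

  -- Normal modalities and the existence lemma, shared by `K[ a ]_` and `D[ G ]_`.

  record Normal (□ : Fm → Fm) : Set where
    field
      necessitation : ∀ {φ} → Λ ⊢ φ → Λ ⊢ □ φ
      distributes   : ∀ φ ψ → Λ ⊢ □ (φ ⇒ ψ) ⇒ □ φ ⇒ □ ψ

  K-normal : ∀ a → Normal (K[ a ]_)
  K-normal a = record { necessitation = K-nec a ; distributes = K-dist a }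

  _⟶[_]_ : World → (Fm → Fm) → World → Set
  s ⟶[ □ ] t = ∀ {φ} → s ∋ □ φ → t ∋ φ

  module _ {□ : Fm → Fm} (normal : Normal □) where

    open Normal normal

    ∋-□-closed : ∀ s {φ} → (λ ψ → s ∋ □ ψ) ⊩ φ → s ∋ □ φ
    ∋-□-closed s (hyp x)   = x
    ∋-□-closed s (thm x)   = sound s (necessitation x)
    ∋-□-closed s (app f x) = to (imp⇔ s) (∋-mp s (distributes _ _) (∋-□-closed s f)) (∋-□-closed s x)

    existence : ∀ s {φ} → ¬ (s ∋ □ φ) → ∃[ t ] (s ⟶[ □ ] t × ¬ (t ∋ φ))
    existence s ¬x = lindenbaum (¬x ∘ ∋-□-closed s)

  -- Agreement on a set of formulas, and definability.

  infix 4 _≈⟨_⟩_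

  _≈⟨_⟩_ : World → Pred Fm 0ℓ → World → Set
  s ≈⟨ Σ ⟩ t = ∀ {φ} → Σ φ → holds s φ ≡ holds t φ

  ≈-∋ : ∀ {Σ} s t {φ} → s ≈⟨ Σ ⟩ t → Σ φ → s ∋ φ → t ∋ φ
  ≈-∋ s t e i = subst T (e i)

  ≈-sym : ∀ {Σ} s t → s ≈⟨ Σ ⟩ t → t ≈⟨ Σ ⟩ s
  ≈-sym s t e i = sym (e i)

  Definable : (World → Set) → Set
  Definable P = ∃[ χ ] (∀ s → s ∋ χ ⇔ P s)

  -- Induction on the list. With nothing to compare, `P` is constant. Otherwise `P` is split by the
  -- value `b` of `σ`: the closure `P[ b ]` of that part under agreement on the tail is definable,
  -- and coincides with `P` where `σ` has value `b`.
  definable : ∀ L (P : World → Set) → (∀ {s t} → s ≈⟨ _∈ L ⟩ t → P s → P t) → Definable P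
  definable [] P inv with em {∃[ s ] P s}
  ... | yes (_ , p) = ⊤̇ , λ s → mk⇔ (λ _ → inv (λ ()) p) (λ _ → ∋-⊤ s)
  ... | no ¬p       = ¬̇ ⊤̇ , λ s → mk⇔ (λ x → contradiction (∋-⊤ s) (to (neg⇔ s) x))
                                      (λ p → contradiction (s , p) ¬p)
  definable (σ ∷ L) P inv = χ , λ s → mk⇔ (sound-χ s) (complete-χ s)
    where
    P[_] : Bool → World → Set
    P[ b ] s = ∃[ t ] (t ≈⟨ _∈ L ⟩ s × holds t σ ≡ b × P t)

    P[_]-definable : ∀ b → Definable P[ b ]
    P[ b ]-definable = definable L P[ b ] λ e (t , e′ , q , p) → t , (λ i → trans (e′ i) (e i)) , q , p

    χ₁ = proj₁ P[ true ]-definable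
    χ₀ = proj₁ P[ false ]-definable
    χ  = (σ ⇒ χ₁) ∧̇ (¬̇ σ ⇒ χ₀)

    collapse : ∀ {b s} → holds s σ ≡ b → P[ b ] s → P s
    collapse q (t , e , q′ , p) =
      inv (λ { (here refl) → trans q′ (sym q) ; (there i) → e i }) p

    sound-χ : ∀ s → s ∋ χ → P s
    sound-χ s x with holds s σ in q | to (∋-∧⇔ s) x
    ... | true  | y , _ = collapse q (to (proj₂ P[ true ]-definable s)
                            (to (imp⇔ s) y (subst T (sym q) tt)))
    ... | false | _ , z = collapse q (to (proj₂ P[ false ]-definable s)
                            (to (imp⇔ s) z (from (neg⇔ s) (subst T q))))

    complete-χ : ∀ s → P s → s ∋ χ
    complete-χ s p with holds s σ in q
    ... | true  = from (∋-∧⇔ s)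
      ( from (imp⇔ s) (λ _ → from (proj₂ P[ true ]-definable s) (s , (λ _ → refl) , q , p))
      , from (imp⇔ s) (λ y → contradiction (subst T (sym q) tt) (to (neg⇔ s) y)) )
    ... | false = from (∋-∧⇔ s)
      ( from (imp⇔ s) (λ y → contradiction (subst T q y) id)
      , from (imp⇔ s) (λ _ → from (proj₂ P[ false ]-definable s) (s , (λ _ → refl) , q , p)) )

  -- Filtered frames and the truth lemma.

  ⊩-complete : ∀ {Φ φ} → (∀ s → (∀ ψ → Φ ψ → s ∋ ψ) → s ∋ φ) → Φ ⊩ φ
  ⊩-complete {Φ} {φ} h with em {Φ ⊩ φ}
  ... | yes p = p
  ... | no ¬p = let s , Φ∈s , ¬x = lindenbaum ¬p in contradiction (h s (λ _ → Φ∈s)) ¬x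

  -- s ⇝⟨ Σ ⟩[ □ ] t is the smallest filtration of s ⟶[ □ ] t through Σ.

  infix 4 _⇝⟨_⟩[_]_

  _⇝⟨_⟩[_]_ : World → Pred Fm 0ℓ → (Fm → Fm) → World → Set
  s ⇝⟨ Σ ⟩[ □ ] t = ∃[ s′ ] ∃[ t′ ] (s ≈⟨ Σ ⟩ s′ × s′ ⟶[ □ ] t′ × t′ ≈⟨ Σ ⟩ t)

  record Frame (Σ : Pred Fm 0ℓ) : Set₁ where
    field
      Pt         : Set
      th         : Pt → World
      Edge       : Pt → Pt → Fin n → Set
      surjective : ∀ s → ∃[ u ] th u ≡ s
      K-sound    : ∀ u v {a} → Edge u v a → th u ⇝⟨ Σ ⟩[ K[ a ]_ ] th v
      -- `φ` need not lie in `Σ`, and `s` need only agree with `th u` on `Σ`: the induction for `C`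
      -- uses this for a defining formula that may be outside `Σ`.
      K-complete : ∀ u s {a φ} → th u ≈⟨ Σ ⟩ s → ¬ (s ∋ K[ a ] φ) →
                   ∃[ v ] (Edge u v a × ¬ (th v ∋ φ))
      D-sound    : ∀ u v {G χ φ} → IsD G χ φ → Σ χ → (∀ a → a ∈ᵍ G → Edge u v a) →
                   th u ∋ χ → th v ∋ φ
      D-complete : ∀ u {G χ φ} → IsD G χ φ → ¬ (th u ∋ χ) →
                   ∃[ v ] ((∀ a → a ∈ᵍ G → Edge u v a) × ¬ (th v ∋ φ))

    -- Each agent is its own sole skill, so `C a ⊆ E u v` amounts to `Edge u v a`, and
    -- `⋃C G ⊆ E u v` to an edge for every member of `G`.
    model : Pt → Model n
    model o = record
      { W = Pt ; inhabited = o ; A = Fin n ; E = Edge ; C = _≡_ ; ν = λ u p → th u ∋ ` p }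

  module Truth {Σ : Pred Fm 0ℓ} (closed : SubformulaClosed Σ)
               (finite : c ≡ true → ∃[ L ] (Σ ⊆ (_∈ L))) (F : Frame Σ) (o : Frame.Pt F) where

    open Frame F
    open Model (model o) using (Everyone^[1+_])

    truth : ∀ φ → Σ φ → ∀ u → (model o , u ⊨ φ) ⇔ th u ∋ φ
    truth (` p) i u = mk⇔ id id
    truth (¬̇ φ) i u = mk⇔
      (λ ¬x → from (neg⇔ (th u)) (¬x ∘ from IH))
      (λ x → to (neg⇔ (th u)) x ∘ to IH)
      where IH = truth φ (closed ¬-arg i) u
    truth (φ ⇒ ψ) i u = mk⇔
      (λ f → from (imp⇔ (th u)) (to IHψ ∘ f ∘ from IHφ))
      (λ x → from IHψ ∘ to (imp⇔ (th u)) x ∘ to IHφ)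
      where
      IHφ = truth φ (closed ⇒-lhs i) u
      IHψ = truth ψ (closed ⇒-rhs i) u
    truth (K[ a ] φ) i u = mk⇔
      (λ h → ∋-stable (th u) λ ¬x →
        let v , e , ¬y = K-complete u (th u) (λ _ → refl) ¬x
        in ¬y (to (IH v) (h v (λ { refl → e }))))
      (λ x v e →
        let s , t , e₁ , r , e₂ = K-sound u v (e refl)
        in from (IH v) (≈-∋ t (th v) e₂ (closed K-arg i) (r (≈-∋ (th u) s e₁ i x))))
      where IH = truth φ (closed K-arg i)
    truth (D[ G ] φ) i u = mk⇔
      (λ h → ∋-stable (th u) λ ¬x →
        let v , e , ¬y = D-complete u (isD G φ) ¬x
        in ¬y (to (IH v) (h v λ { (a , a∈G , refl) → e a a∈G })))
      (λ x v e → from (IH v) (D-sound u v (isD G φ) i (λ a a∈G → e (a , a∈G , refl)) x))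
      where IH = truth φ (closed D-arg i)
    truth (C[ G ] φ) i u = mk⇔
      (λ h → ∋-mp (th u) (C-ind G invariant) (from (χ⇔ (th u)) (u , (λ _ → refl) , h)))
      (λ x k → unfold k u x)
      where
      IH = truth φ (closed C-arg i)

      X : Pt → Set
      X v = model o , v ⊨ φ

      Common : Pt → Set
      Common v = ∀ k → Everyone^[1+ k ] G X v

      Σ-finite = finite refl

      -- Closing `Common` under agreement on `Σ` gives the invariance that `definable` requires.
      common : Definable (λ s → ∃[ v ] (th v ≈⟨ Σ ⟩ s × Common v))
      common = definable (proj₁ Σ-finite) _
        λ e (v , e′ , h) → v , (λ j → trans (e′ j) (e (proj₂ Σ-finite j))) , h

      χ  = proj₁ common
      χ⇔ = proj₂ common

      -- Let `s` satisfy `χ`, witnessed by a point `v` agreeing with `s` on `Σ`. If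
      -- `K[ a ] (χ ∧̇ φ)` failed at `s`, then `v` would have an `a`-successor `w` refuting
      -- `χ ∧̇ φ`; but `w` inherits common knowledge of `φ` from `v` and satisfies `φ`.
      invariant : Λ ⊢ χ ⇒ E[ G ] (χ ∧̇ φ)
      invariant = everywhere⇒⊢ λ s → from (imp⇔ s) λ x → from (∋-E⇔ s G) λ a a∈G →
        ∋-stable s λ ¬y →
          let v , e , h  = to (χ⇔ s) x
              w , f , ¬z = K-complete v s e ¬y
          in ¬z (from (∋-∧⇔ (th w))
               -- Index `k` stands for exponent `k + 1`: index 0 gives `φ` at `w`, index `suc k`
               -- gives index `k` there.
               ( from (χ⇔ (th w)) (w , (λ _ → refl) , λ k → h (suc k) a a∈G w (λ { refl → f }))
               , to (IH w) (h 0 a a∈G w (λ { refl → f })) ))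

      -- Only `C[ G ] φ` and `φ`, both in `Σ`, cross the agreements at the two ends of the edge;
      -- `C-mix` is unfolded in between, along a canonical step.
      step : ∀ {a} v w → a ∈ᵍ G → Edge v w a → th v ∋ C[ G ] φ → X w × th w ∋ C[ G ] φ
      step {a} v w a∈G e x =
        let s , t , e₁ , r , e₂ = K-sound v w e
            y  = to (∋-E⇔ s G) (∋-mp s (C-mix G φ) (≈-∋ (th v) s e₁ i x)) a a∈G
            z , z′ = to (∋-∧⇔ t) (r y)
        in from (IH w) (≈-∋ t (th w) e₂ (closed C-arg i) z) , ≈-∋ t (th w) e₂ i z′

      unfold : ∀ k v → th v ∋ C[ G ] φ → Everyone^[1+ k ] G X v
      unfold zero    v x a a∈G w e = proj₁ (step v w a∈G (e refl) x)
      unfold (suc k) v x a a∈G w e = unfold k w (proj₂ (step v w a∈G (e refl) x))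

  frame-complete : ∀ {Σ} → SubformulaClosed Σ → (c ≡ true → ∃[ L ] (Σ ⊆ (_∈ L))) →
    (F : Frame Σ) → let open Frame F in ∀ {Φ φ} → Φ ⊆ Σ → Σ φ →
    (∀ u → (∀ ψ → Φ ψ → model u , u ⊨ ψ) → model u , u ⊨ φ) → Φ ⊩ φ
  frame-complete closed finite F {φ = φ} Φ⊆Σ i h = ⊩-complete λ s Φ∈s → case s Φ∈s
    where
    open Frame F
    open Truth closed finite F
    case : ∀ s → _ → s ∋ φ
    case s Φ∈s with surjective s
    ... | u , refl = to (truth u φ i u) (h u λ ψ j → from (truth u ψ (Φ⊆Σ j) u) (Φ∈s ψ j))

-- Frames for languages without `D`.

module _ (em : ExcludedMiddle 0ℓ) {n : ℕ} {c : Bool} (Λ : Logic c false) where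

  open Worlds em {n} Λ

  plainFrame : (Σ : Pred (Form n c false) 0ℓ) → Frame Σ
  plainFrame Σ = record
    { Pt         = World
    ; th         = id
    ; Edge       = λ s t a → s ⇝⟨ Σ ⟩[ K[ a ]_ ] t
    ; surjective = _, refl
    ; K-sound    = λ _ _ → id
    ; K-complete = λ _ s {a} e ¬x →
                     let t , r , ¬y = existence (K-normal a) s ¬x
                     -- The canonical step starts at `s`; the filtration absorbs the agreement `e`.
                     in t , (s , t , e , r , λ _ → refl) , ¬y
    ; D-sound    = λ _ _ ()
    ; D-complete = λ _ ()
    }

-- Frames for languages with `D`.

module _ (em : ExcludedMiddle 0ℓ) {n : ℕ} {c : Bool} (Λ : Logic c true) where

  open Worlds em {n} Λ

  D-single⁺ : ∀ s {a φ} → s ∋ K[ a ] φ → s ∋ D[ ⟨ a ⟩ ] φ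
  D-single⁺ s x = to (imp⇔ s) (proj₂ (to (∋-∧⇔ s) (sound s (D-single _ _)))) x

  D-single⁻ : ∀ s {a φ} → s ∋ D[ ⟨ a ⟩ ] φ → s ∋ K[ a ] φ
  D-single⁻ s x = to (imp⇔ s) (proj₁ (to (∋-∧⇔ s) (sound s (D-single _ _)))) x

  K⇒D : ∀ {a φ} G → a ∈ᵍ G → Λ ⊢ K[ a ] φ ⇒ D[ G ] φ
  K⇒D {a} G a∈G = everywhere⇒⊢ λ s → from (imp⇔ s) λ x →
    ∋-mp s (D-mono ⟨ a ⟩ G _ (λ b∈ → subst (_∈ᵍ G) (sym (x∈⁅y⁆⇒x≡y a b∈)) a∈G)) (D-single⁺ s x)

  -- Necessitation for `D` is derived from that for `K` at some member of `G`, which exists as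
  -- groups are nonempty.
  D-normal : ∀ G → Normal (D[ G ]_)
  D-normal G = record
    { necessitation = λ p → let a , a∈G = member G in mp (K-nec a p) (K⇒D G a∈G)
    ; distributes   = D-dist G
    }

  -- The agents of G all have an edge into (t , H) just when G ⊆ H and t is
  -- D[ H ]-accessible.  Hence D[ G ] is interpreted by an intersection,
  -- which the canonical relation for D[ G ] need not be.

  labelledFrame : (Σ : Pred (Form n c true) 0ℓ) → SubformulaClosed Σ → Group n → Frame Σ
  labelledFrame Σ closed o = record
    { Pt         = Pt
    ; th         = proj₁
    ; Edge       = Edge
    ; surjective = λ s → (s , o) , refl
    ; K-sound    = λ { _ (_ , H) (a∈H , s , t , e , r , e′) →
                       s , t , e , (λ x → r (∋-mp s (K⇒D H a∈H) x)) , e′ }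
    ; K-complete = λ _ s {a} e ¬x →
                     let t , r , ¬y = existence (D-normal ⟨ a ⟩) s (¬x ∘ D-single⁻ s)
                     in (t , ⟨ a ⟩) , (x∈⁅x⁆ a , s , t , e , r , λ _ → refl) , ¬y
    ; D-sound    = D-sound
    ; D-complete = D-complete
    }
    where
    Pt : Set
    Pt = World × Group n

    Edge : Pt → Pt → Fin n → Set
    Edge (s , _) (t , H) a = a ∈ᵍ H × s ⇝⟨ Σ ⟩[ D[ H ]_ ] t

    -- The edges together give `G ⊆ H`, and any one of them, available since `G` is nonempty, gives
    -- the filtered `D[ H ]` step. `D[ G ] φ` is in `Σ` and so passes to `s′`, where it is raised to
    -- `D[ H ] φ`, which need not be in `Σ`.
    D-sound : ∀ (u v : Pt) {G χ φ} → IsD G χ φ → Σ χ →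
              (∀ a → a ∈ᵍ G → Edge u v a) → proj₁ u ∋ χ → proj₁ v ∋ φ
    D-sound (s , _) (t , H) (isD G φ) i e x =
      let a , a∈G = member G
          _ , s′ , t′ , e₁ , r , e₂ = e a a∈G
          y = ∋-mp s′ (D-mono G H φ (λ b∈G → proj₁ (e _ b∈G))) (≈-∋ s s′ e₁ i x)
      in ≈-∋ t′ t e₂ (closed D-arg i) (r y)

    D-complete : ∀ (u : Pt) {G χ φ} → IsD G χ φ → ¬ (proj₁ u ∋ χ) →
                 ∃[ v ] ((∀ a → a ∈ᵍ G → Edge u v a) × ¬ (proj₁ v ∋ φ))
    D-complete (s , _) (isD G φ) ¬x =
      let t , r , ¬y = existence (D-normal G) s ¬x
      in (t , G) , (λ a a∈G → a∈G , s , t , (λ _ → refl) , r , λ _ → refl) , ¬y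

-- Symmetry from axiom `B`.

module _ (em : ExcludedMiddle 0ℓ) {n : ℕ} where

  open Worlds em {n} 𝐊𝐁

  -- If `φ` failed at `s`, axiom `B` for `¬̇ φ` would make `K[ a ] ¬̇ ¬̇ φ` fail at `t`, although it
  -- follows from `K[ a ] φ`.
  ⟶-symmetric : ∀ {a} s t → s ⟶[ K[ a ]_ ] t → t ⟶[ K[ a ]_ ] s
  ⟶-symmetric {a} s t r {φ} x = ∋-stable s λ ¬y →
    to (neg⇔ t) (r (∋-mp s (B a (¬̇ φ)) (from (neg⇔ s) ¬y)))
      (to (imp⇔ t) (∋-mp t (K-dist a φ _) (sound t (K-nec a ¬¬-intro))) x)
    where
    ¬¬-intro : 𝐊𝐁 ⊢ φ ⇒ ¬̇ ¬̇ φ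
    ¬¬-intro = everywhere⇒⊢ λ s → from (imp⇔ s) λ x → from (neg⇔ s) λ y → to (neg⇔ s) y x

  plainFrame-symmetric : ∀ Σ u → Symmetric (Frame.model (plainFrame em 𝐊𝐁 Σ) u)
  plainFrame-symmetric Σ u s t = (λ {a} → converse a s t) , (λ {a} → converse a t s)
    where
    converse : ∀ a s t → s ⇝⟨ Σ ⟩[ K[ a ]_ ] t → t ⇝⟨ Σ ⟩[ K[ a ]_ ] s
    converse a s t (s′ , t′ , e , r , e′) =
      t′ , s′ , ≈-sym t′ t e′ , ⟶-symmetric s′ t′ r , ≈-sym s s′ e

theorem21 : ExcludedMiddle 0ℓ → (n : ℕ) .{{_ : NonZero n}} →
    (∀ (φ : EL n) (Φ : Pred (EL n) 0ℓ) → Φ ⊨ φ → Φ ⊢[ 𝐊 ] φ) ×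
    (∀ (φ : ELC n) → Valid φ → 𝐊𝐂 ⊢ φ) ×
    (∀ (φ : ELD n) (Φ : Pred (ELD n) 0ℓ) → Φ ⊨ φ → Φ ⊢[ 𝐊𝐃 ] φ) ×
    (∀ (φ : ELCD n) → Valid φ → 𝐊𝐂𝐃 ⊢ φ) ×
    (∀ (φ : EL n) (Φ : Pred (EL n) 0ℓ) → Φ ⊨ˢʸᵐ φ → Φ ⊢[ 𝐊𝐁 ] φ)
theorem21 em n@(suc _) =
    (λ φ Φ h → strong 𝐊 (λ ()) (plainFrame em 𝐊 U) (λ u → h _ u))
  , (λ φ h → weak 𝐊𝐂 φ (plainFrame em 𝐊𝐂 _) (λ u → h _ u))
  -- `⟨ zero ⟩` exists because there is an agent. It labels the points chosen over given worlds;
  -- edges ignore the label of their source, so any group would do.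
  , (λ φ Φ h → strong 𝐊𝐃 (λ ()) (labelledFrame em 𝐊𝐃 U _ ⟨ zero ⟩) (λ u → h _ u))
  , (λ φ h → weak 𝐊𝐂𝐃 φ (labelledFrame em 𝐊𝐂𝐃 _ (subformulas-closed φ) ⟨ zero ⟩) (λ u → h _ u))
  , (λ φ Φ h → strong 𝐊𝐁 (λ ()) (plainFrame em 𝐊𝐁 U) (λ u → h _ (plainFrame-symmetric em U u) u))
  where
  -- `U` fits into no finite list, so `C`, whose truth case rests on definability, must be absent.
  strong : ∀ {c d} (Λ : Logic c d) → ¬ (c ≡ true) → let open Worlds em {n} Λ in
    (F : Frame U) → ∀ {Φ φ} → let open Frame F in
    (∀ u → (∀ ψ → Φ ψ → model u , u ⊨ ψ) → model u , u ⊨ φ) → Φ ⊢[ Λ ] φ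
  strong Λ noC F h = ⊩-finite (frame-complete _ (λ p → contradiction p noC) F _ _ h)
    where open Worlds em {n} Λ

  weak : ∀ {c d} (Λ : Logic c d) (φ : Form n c d) → let open Worlds em {n} Λ in
    (F : Frame (_∈ subformulas φ)) → let open Frame F in
    (∀ u → model u , u ⊨ φ) → Λ ⊢ φ
  weak Λ φ F h =
    ⊩⇒⊢ (frame-complete (subformulas-closed φ) (λ _ → subformulas φ , id) F (λ ()) (here refl) (λ u _ → h u))
    where open Worlds em {n} Λ
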